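{- Let $G$ be a directed graph on the vertex set $[n+1]$ and let $\mathbf{c}'=(c_1,\ldots,c_n,-\sum_{i=1}^n c_i)\in\mathbb{Z}^{n+1}$ be any net flow vector. Then $$K_G(\mathbf{c}')=\big|\mathcal{GD}_G(\mathbf{c}')\big|,$$ where $K_G$ is the Kostant partition function of $G$ and $\mathcal{GD}_G(\mathbf{c}')$ is the set of gravity diagrams.
   Context: Directed graphs $G$ have vertex set $[n+1]=\{1,\ldots,n+1\}$, may have multiple edges, and every edge $(i,j)$ is directed from a smaller vertex $i$ to a larger vertex $j$. Kostant partition function: $K_G(\mathbf{c}')$ is the number of tuples $(b_e)_{e\in E(G)}$ of nonnegative integers such that $\sum_{e=(i,j)\in E(G)} b_e(\mathbf{e}_i-\mathbf{e}_j)=\mathbf{c}'$ (each copy of a multiple edge has its own $b_e$), where $\mathbf{e}_i$ denotes the standard basis vectors. Gravity diagrams: put $\boldsymbol{\alpha}_i=\mathbf{e}_i-\mathbf{e}_{i+1}$, so $\mathbf{e}_i-\mathbf{e}_j=\boldsymbol{\alpha}_i+\cdots+\boldsymbol{\alpha}_{j-1}$ and $\mathbf{c}'=\sum_{i=1}^n d_i\boldsymbol{\alpha}_i$ with $d_i=c_1+\cdots+c_i$. If some $d_i<0$, there are no diagrams. Otherwise take an array of dots with $n$ columns and $d_i$ dots in column $i$. A line-dot diagram is a partition of the set of all dots into blocks called lines (a single dot being a line of length $0$), together with an assignment of an edge of $G$ to each line, such that a line assigned to an edge $(i,j)$ consists of exactly one dot from each of the columns $i,i+1,\ldots,j-1$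 and no other dots. A line assigned to $(i,j)$ represents the part $[\boldsymbol{\alpha}_i+\cdots+\boldsymbol{\alpha}_{j-1}]$ (if there are several parallel edges $(i,j)$, the parts are distinguished by the edge). Two line-dot diagrams are equivalent if they represent the same vector partition of $\mathbf{c}'$, i.e. for every edge of $G$ they have the same number of lines assigned to it. A gravity diagram is an equivalence class of line-dot diagrams; $\mathcal{GD}_G(\mathbf{c}')$ is the set of them. -}

module Defs where

open import Data.Bool.Base using (if_then_else_)
open import Data.Fin.Base using (Fin; zero; suc; fromℕ; inject₁; _≤_; _<_)
open import Data.Fin.Properties using (_≟_)
open import Data.Integer.Base as ℤ using (ℤ; +_; 0ℤ; 1ℤ; -_; _+_; _-_; _*_; ∣_∣)
open import Data.Integer.Properties using (+-0-monoid)
open import Data.Nat.Base using (ℕ; suc)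
open import Data.Product using (Σ; ∃; ∃!; _×_; _,_; proj₁)
open import Data.Vec.Base using (count; tabulate)
open import Data.Vec.Functional using (Vector; head; tail; insertAt)
open import Function.Bundles using (Bijection)
open import Level using (0ℓ)
open import Relation.Binary.Bundles using (Setoid)
import Relation.Binary.Construct.On as On
open import Relation.Binary.PropositionalEquality using (_≡_; _→-setoid_; setoid)
open import Relation.Nullary.Decidable using (does)

open import Algebra.Properties.Monoid.Sum +-0-monoid using (sum)

-- Vertices are numbered from 0, so the vertex set [n+1] is Fin (suc n).
-- Parallel edges are distinct elements of Fin size with equal endpoints.
record Graph (n : ℕ) : Set where
  field
    size    : ℕ
    src tgt : Fin size → Fin (suc n)
    src<tgt : ∀ e → src e < tgt e

  Edge : Set
  Edge = Fin size

-- The setoid S has exactly k elements up to its equality.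
HasCardinality : Setoid 0ℓ 0ℓ → ℕ → Set
HasCardinality S k = Bijection S (setoid (Fin k))

basis : ∀ {n} → Fin n → Vector ℤ n
basis i k = if does (i ≟ k) then 1ℤ else 0ℤ

-- (c₁ , … , cₙ , - (c₁ + ⋯ + cₙ))
netFlow : ∀ {n} → Vector ℤ n → Vector ℤ (suc n)
netFlow {n} c = insertAt c (fromℕ n) (- sum c)

-- partialSum c i sums the entries of c up to and including position i.
partialSum : ∀ {n} → Vector ℤ n → Vector ℤ n
partialSum c zero            = head c
partialSum {suc _} c (suc i) = head c + partialSum (tail c) i

module _ {n : ℕ} (G : Graph n) (c′ : Vector ℤ (suc n)) where
  open Graph G

  IsFlow : (Edge → ℕ) → Set
  IsFlow b = ∀ k → sum (λ e → + b e * (basis (src e) k - basis (tgt e) k)) ≡ c′ k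

  Flow : Set
  Flow = Σ (Edge → ℕ) IsFlow

  -- Flows are compared by their values b alone, not by the proofs of IsFlow.
  flowSetoid : Setoid 0ℓ 0ℓ
  flowSetoid = On.setoid {B = Flow} (Edge →-setoid ℕ) proj₁

  -- K_G(c′) = k
  KostantPartitionFunction : ℕ → Set
  KostantPartitionFunction k = HasCardinality flowSetoid k

  -- The coefficients d of c′ in the basis αᵢ = eᵢ - eᵢ₊₁, for c′ with zero sum.
  simpleRootCoeff : Vector ℤ n
  simpleRootCoeff i = partialSum c′ (inject₁ i)

  -- A dot is a column together with a position in that column.  The absolute
  -- value is harmless: diagrams require all coefficients to be nonnegative.
  Dot : Set
  Dot = Σ (Fin n) λ i → Fin ∣ simpleRootCoeff i ∣

  -- Column i belongs to the interval of columns src e , … , tgt e - 1.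
  _Spans_ : Edge → Fin n → Set
  e Spans i = src e ≤ inject₁ i × inject₁ i < tgt e

  -- The partition of the dots into lines is the family of fibres of lineOf; the
  -- numbering of the lines by Fin #lines is forgotten by the equivalence below.
  record LineDotDiagram : Set where
    field
      coeff≥0  : ∀ i → 0ℤ ℤ.≤ simpleRootCoeff i
      #lines   : ℕ
      lineOf   : Dot → Fin #lines
      nonempty : ∀ l → ∃ λ x → lineOf x ≡ l
      edgeOf   : Fin #lines → Edge
      oneDot   : ∀ l i → edgeOf l Spans i → ∃! _≡_ λ r → lineOf (i , r) ≡ l
      noOthers : ∀ l i r → lineOf (i , r) ≡ l → edgeOf l Spans i

    multiplicity : Edge → ℕ
    multiplicity e = count (_≟ e) (tabulate edgeOf)

  -- Gravity diagrams: line-dot diagrams, identified when every edge is assigned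
  -- to equally many lines in both.
  gravityDiagrams : Setoid 0ℓ 0ℓ
  gravityDiagrams = On.setoid (Edge →-setoid ℕ) LineDotDiagram.multiplicity

{-# OPTIONS --safe #-}

-- Taking partial sums turns flow conservation at the vertices into the
-- condition that, for every column k, the total flow on the edges spanning k
-- is d_k.  A line-dot diagram is, column by column, a bijection between the d_k
-- dots and the lines spanning k, so its edge multiplicities form a flow.
-- Conversely, given a flow b, take b e lines for every edge e: then exactly d_k
-- lines span column k, and any choice of bijections yields a diagram.
module Submission where

open import Defs
open import Data.Bool.Base using (true; false; if_then_else_)
open import Data.Fin.Base as Fin using (Fin; zero; suc; toℕ; fromℕ; fromℕ<; inject₁; splitAt; finToFun; funToFin)
open import Data.Fin.Properties as Fin using (_≟_)
open import Data.Fin.Relation.Unary.Top using (view; ‵fromℕ; ‵inject₁)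
open import Data.Integer.Base as ℤ using (ℤ; +_; 0ℤ; 1ℤ; ∣_∣)
import Data.Integer.Properties as ℤ
open import Data.Integer.Tactic.RingSolver using (solve-∀)
open import Data.Nat.Base as ℕ using (ℕ; zero; suc; _+_; _*_; _≤_; s≤s)
import Data.Nat.Properties as ℕ
open import Data.Product using (∃; Σ; _×_; _,_; proj₁; proj₂; map₂)
open import Data.Sum.Base using (_⊎_; inj₁; inj₂; [_,_]′; map₁)
open import Data.Vec.Base using (count; tabulate)
open import Data.Vec.Functional using (Vector; head; tail; insertAt)
open import Function.Base using (_∘_; const)
open import Function.Bundles using (Bijection; _⇔_; mk⇔)
import Function.Construct.Composition as Compose
open import Level using (0ℓ)
import Relation.Binary.Construct.On as On
open import Relation.Binary.PropositionalEquality
open import Relation.Nullary using (Dec; yes; no; does; ¬_; contradiction)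
open import Relation.Nullary.Decidable using (_×-dec_; dec-true; dec-false; does-⇔)
open import Relation.Unary using (Pred; Decidable)

open import Algebra.Properties.AbelianGroup ℤ.+-0-abelianGroup using (∙-cancelˡ)
open import Algebra.Properties.Semiring.Sum ℕ.+-*-semiring
  using (sum; sum-cong-≗; ∑-comm; *-distribʳ-sum)
import Algebra.Properties.CommutativeMonoid.Sum ℤ.+-0-commutativeMonoid as ℤΣ

open ≡-Reasoning

-- Indicators of decidable propositions

𝟙 : ∀ {P : Set} → Dec P → ℕ
𝟙 P? = if does P? then 1 else 0

𝟙-true : ∀ {P : Set} (P? : Dec P) → P → 𝟙 P? ≡ 1
𝟙-true P? p = cong (λ t → if t then 1 else 0) (dec-true P? p)

𝟙-false : ∀ {P : Set} (P? : Dec P) → ¬ P → 𝟙 P? ≡ 0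
𝟙-false P? ¬p = cong (λ t → if t then 1 else 0) (dec-false P? ¬p)

𝟙-cong : ∀ {P Q : Set} → P ⇔ Q → (P? : Dec P) (Q? : Dec Q) → 𝟙 P? ≡ 𝟙 Q?
𝟙-cong P⇔Q P? Q? = cong (λ t → if t then 1 else 0) (does-⇔ P⇔Q P? Q?)

-- The hypotheses make `R` a part of `P` and `Q` its complement, so removing `R` from `P` leaves
-- what `P` shares with `Q`.
𝟙-difference : ∀ {P Q R : Set} (P? : Dec P) (Q? : Dec Q) (R? : Dec R) →
  (R → P) → (Q → ¬ R) → (¬ Q → R) → + 𝟙 P? ℤ.- + 𝟙 R? ≡ + 𝟙 (P? ×-dec Q?)
𝟙-difference _       (yes q) (yes r) _   q⇒¬r _    = contradiction r (q⇒¬r q)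
𝟙-difference _       (no ¬q) (no ¬r) _   _    ¬q⇒r = contradiction (¬q⇒r ¬q) ¬r
𝟙-difference (yes _) (yes _) (no _)  _   _    _    = refl
𝟙-difference (yes _) (no _)  (yes _) _   _    _    = refl
𝟙-difference (no _)  (yes _) (no _)  _   _    _    = refl
𝟙-difference (no ¬p) (no _)  (yes r) r⇒p _    _    = contradiction (r⇒p r) ¬p

-- Enumerations of decidable subsets

-- Injectivity and surjectivity concern elements of `Fin m` only, so it does not matter how many
-- proofs `P x` has.
record Enumeration {m : ℕ} (P : Pred (Fin m) 0ℓ) (k : ℕ) : Set where
  field
    pick            : Fin k → Fin m
    pick-satisfies  : ∀ j → P (pick j)
    pick-injective  : ∀ {i j} → pick i ≡ pick j → i ≡ j
    pick-surjective : ∀ {x} → P x → ∃ λ j → pick j ≡ x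

open Enumeration

-- Writing the size as a sum of indicators allows it to be regrouped by edges later.
enumerate : ∀ {m} {P : Pred (Fin m) 0ℓ} (P? : Decidable P) → Enumeration P (sum (λ x → 𝟙 (P? x)))
enumerate {zero}  P? = record
  { pick = λ () ; pick-satisfies = λ () ; pick-injective = λ {} ; pick-surjective = λ {} }
enumerate {suc m} {P} P? with P? zero | enumerate (P? ∘ suc)
... | no ¬p | E = record
  { pick            = suc ∘ pick E
  ; pick-satisfies  = pick-satisfies E
  ; pick-injective  = pick-injective E ∘ Fin.suc-injective
  ; pick-surjective = surj
  }
  where
  surj : ∀ {x} → P x → ∃ λ j → suc (pick E j) ≡ x
  surj {zero}  p = contradiction p ¬p
  surj {suc x} p = map₂ (cong suc) (pick-surjective E p)
... | yes p | E = record
  { pick            = pick⁺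
  ; pick-satisfies  = λ { zero → p ; (suc j) → pick-satisfies E j }
  ; pick-injective  = inj
  ; pick-surjective = surj
  }
  where
  pick⁺ : Fin (suc _) → Fin (suc m)
  pick⁺ zero    = zero
  pick⁺ (suc j) = suc (pick E j)

  inj : ∀ {i j} → pick⁺ i ≡ pick⁺ j → i ≡ j
  inj {zero}  {zero}  _  = refl
  inj {zero}  {suc j} ()
  inj {suc i} {zero}  ()
  inj {suc i} {suc j} eq = cong suc (pick-injective E (Fin.suc-injective eq))

  surj : ∀ {x} → P x → ∃ λ j → pick⁺ j ≡ x
  surj {zero}  _ = zero , refl
  surj {suc x} q with j , eq ← pick-surjective E q = suc j , cong suc eq

module _ {m j k : ℕ} {P : Pred (Fin m) 0ℓ} where

  private
    index : Enumeration P j → Enumeration P k → Fin j → Fin k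
    index E F x = proj₁ (pick-surjective F (pick-satisfies E x))

    pick-index : ∀ E F x → pick F (index E F x) ≡ pick E x
    pick-index E F x = proj₂ (pick-surjective F (pick-satisfies E x))

  reindex-injective : (E : Enumeration P j) (F : Enumeration P k) →
    ∃ λ (f : Fin j → Fin k) → ∀ {x y} → f x ≡ f y → x ≡ y
  reindex-injective E F = index E F , λ {x} {y} eq → pick-injective E (begin
    pick E x             ≡⟨ pick-index E F x ⟨
    pick F (index E F x) ≡⟨ cong (pick F) eq ⟩
    pick F (index E F y) ≡⟨ pick-index E F y ⟩
    pick E y             ∎)

-- Each enumeration injects into the other. This later compares the dots of a column with the lines
-- crossing it.
Enumeration-unique : ∀ {m j k} {P : Pred (Fin m) 0ℓ} → Enumeration P j → Enumeration P k → j ≡ k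
Enumeration-unique E F = Fin.cantor-schröder-bernstein
  (proj₂ (reindex-injective E F)) (proj₂ (reindex-injective F E))

-- Finiteness of bounded sets of functions

funToFin-cong : ∀ {m n} {f g : Fin m → Fin n} → f ≗ g → funToFin f ≡ funToFin g
funToFin-cong {zero}  f≗g = refl
funToFin-cong {suc m} f≗g = cong₂ Fin.combine (f≗g zero) (funToFin-cong (f≗g ∘ suc))

module _ {m : ℕ} (B : ℕ) (Q : Pred (Fin m → ℕ) 0ℓ) (Q? : Decidable Q)
         (Q-resp-≗ : ∀ {b b′} → b ≗ b′ → Q b → Q b′)
         (Q-bounded : ∀ b → Q b → ∀ e → b e ≤ B) where

  private
    decode : Fin (suc B ℕ.^ m) → Fin m → ℕ
    decode x = toℕ ∘ finToFun x

    decode-injective : ∀ {x y} → decode x ≗ decode y → x ≡ y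
    decode-injective {x} {y} eq = begin
      x                         ≡⟨ Fin.funToFin-finToFin {m} x ⟨
      funToFin {m} (finToFun x) ≡⟨ funToFin-cong (Fin.toℕ-injective ∘ eq) ⟩
      funToFin {m} (finToFun y) ≡⟨ Fin.funToFin-finToFin {m} y ⟩
      y                         ∎

    decode-surjective : ∀ b → (∀ e → b e ≤ B) → ∃ λ x → decode x ≗ b
    decode-surjective b b≤B = funToFin digits , λ e →
      trans (cong toℕ (Fin.finToFun-funToFin digits e)) (Fin.toℕ-fromℕ< (s≤s (b≤B e)))
      where
      digits : Fin m → Fin (suc B)
      digits e = fromℕ< (s≤s (b≤B e))

    E = enumerate (Q? ∘ decode)

    value : Fin _ → Fin m → ℕ
    value = decode ∘ pick E

    value-injective : ∀ {i j} → value i ≗ value j → i ≡ j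
    value-injective = pick-injective E ∘ decode-injective

    index : ((b , _) : Σ (Fin m → ℕ) Q) → ∃ λ j → value j ≗ b
    -- The code `x` recovers `b` only pointwise, so `Q` has to be transported along `≗`.
    index (b , q) with x , x≗b ← decode-surjective b (Q-bounded b q)
                  with j , refl ← pick-surjective E (Q-resp-≗ (sym ∘ x≗b) q) = j , x≗b

    value-index : ∀ bq → value (proj₁ (index bq)) ≗ proj₁ bq
    value-index = proj₂ ∘ index

  -- A function bounded by `B` is a numeral of `m` digits in base `suc B`; deciding `Q` on each of
  -- these finitely many codes enumerates the set.
  bounded⇒finite : ∃ (HasCardinality (On.setoid {B = Σ (Fin m → ℕ) Q} (Fin m →-setoid ℕ) proj₁))
  bounded⇒finite = _ , record
    { to        = proj₁ ∘ index
    ; cong      = λ {x} {y} x≗y → value-injective λ e →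
        trans (value-index x e) (trans (x≗y e) (sym (value-index y e)))
    ; bijective =
        (λ {x} {y} eq e → trans (sym (value-index x e))
          (trans (cong (λ j → value j e) eq) (value-index y e)))
      , λ j → (value j , pick-satisfies E j) , λ {z} z≗j → value-injective λ e →
          trans (value-index z e) (z≗j e)
    }

-- Sums of natural numbers

entry≤sum : ∀ {m} (f : Vector ℕ m) i → f i ≤ sum f
entry≤sum f zero    = ℕ.m≤m+n _ _
entry≤sum f (suc i) = ℕ.≤-trans (entry≤sum (tail f) i) (ℕ.m≤n+m _ _)

sum-const : ∀ m x → sum {m} (const x) ≡ m * x
sum-const zero    x = refl
sum-const (suc m) x = cong (_+_ x) (sum-const m x)

sum-splitAt : ∀ m {k} (f : Fin m ⊎ Fin k → ℕ) →
  sum (f ∘ splitAt m) ≡ sum (f ∘ inj₁) + sum (f ∘ inj₂)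
sum-splitAt zero    f = refl
sum-splitAt (suc m) f = trans
  (cong (_+_ (f (inj₁ zero))) (sum-splitAt m (f ∘ map₁ suc)))
  (sym (ℕ.+-assoc (f (inj₁ zero)) _ _))

sum-𝟙-≟ : ∀ {m} (g : Vector ℕ m) e → sum (λ e′ → 𝟙 (e ≟ e′) * g e′) ≡ g e
sum-𝟙-≟ {suc m} g zero = begin
  g zero + 0 + sum {m} (const 0) ≡⟨ cong₂ _+_ (ℕ.+-identityʳ _) (trans (sum-const m 0) (ℕ.*-zeroʳ m)) ⟩
  g zero + 0                     ≡⟨ ℕ.+-identityʳ _ ⟩
  g zero                         ∎
-- The head term computes to 0, and comparing successors computes to comparing their predecessors.
sum-𝟙-≟ g (suc e) = sum-𝟙-≟ (tail g) e

count-tabulate : ∀ {m} {A : Set} {P : Pred A 0ℓ} (P? : Decidable P) (f : Fin m → A) →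
  count P? (tabulate f) ≡ sum (λ i → 𝟙 (P? (f i)))
count-tabulate {zero}  P? f = refl
count-tabulate {suc m} P? f with does (P? (f zero))
... | true  = cong suc (count-tabulate P? (f ∘ suc))
... | false = count-tabulate P? (f ∘ suc)

-- Group the indices `l` by their value `f l`: expand `g (f l)` with a Kronecker delta and exchange
-- the two sums.
sum-∘ : ∀ {l m} (f : Fin l → Fin m) (g : Vector ℕ m) →
  sum (g ∘ f) ≡ sum (λ e → count (_≟ e) (tabulate f) * g e)
sum-∘ f g = begin
  sum (λ l → g (f l))                          ≡⟨ sum-cong-≗ (λ l → sum-𝟙-≟ g (f l)) ⟨
  sum (λ l → sum (λ e → 𝟙 (f l ≟ e) * g e))    ≡⟨ ∑-comm (λ l e → 𝟙 (f l ≟ e) * g e) ⟩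
  sum (λ e → sum (λ l → 𝟙 (f l ≟ e) * g e))    ≡⟨ sum-cong-≗ (λ e → *-distribʳ-sum (g e) (λ l → 𝟙 (f l ≟ e))) ⟨
  sum (λ e → sum (λ l → 𝟙 (f l ≟ e)) * g e)    ≡⟨ sum-cong-≗ (λ e → cong (_* g e) (count-tabulate (_≟ e) f)) ⟨
  sum (λ e → count (_≟ e) (tabulate f) * g e)  ∎

-- Lists the elements of `Fin m` in increasing order, each `e` repeated `b e` times; it will assign
-- edges to lines.
withFibres : ∀ {m} (b : Vector ℕ m) → Fin (sum b) → Fin m
withFibres {suc m} b l = [ const zero , suc ∘ withFibres (tail b) ]′ (splitAt (b zero) l)

-- Split off the block of the first value and induct. Taking an indicator for `g` gives the fibre
-- sizes.
sum-withFibres : ∀ {m} (b g : Vector ℕ m) → sum (g ∘ withFibres b) ≡ sum (λ e → b e * g e)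
sum-withFibres {zero}  b g = refl
sum-withFibres {suc m} b g = trans
  (sum-splitAt (b zero) (g ∘ [ const zero , suc ∘ withFibres (tail b) ]′))
  (cong₂ _+_ (sum-const (b zero) (g zero)) (sum-withFibres (tail b) (tail g)))

count-withFibres : ∀ {m} (b : Vector ℕ m) e → count (_≟ e) (tabulate (withFibres b)) ≡ b e
count-withFibres b e = begin
  count (_≟ e) (tabulate (withFibres b))  ≡⟨ count-tabulate (_≟ e) (withFibres b) ⟩
  sum (λ l → 𝟙 (withFibres b l ≟ e))      ≡⟨ sum-withFibres b (λ e′ → 𝟙 (e′ ≟ e)) ⟩
  sum (λ e′ → b e′ * 𝟙 (e′ ≟ e))          ≡⟨ sum-cong-≗ swap ⟩
  sum (λ e′ → 𝟙 (e ≟ e′) * b e′)          ≡⟨ sum-𝟙-≟ b e ⟩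
  b e                                     ∎
  where
  swap : ∀ e′ → b e′ * 𝟙 (e′ ≟ e) ≡ 𝟙 (e ≟ e′) * b e′
  swap e′ = trans (ℕ.*-comm (b e′) _) (cong (_* b e′) (𝟙-cong (mk⇔ sym sym) (e′ ≟ e) (e ≟ e′)))

-- Partial sums

sum-+ : ∀ {m} (f : Vector ℕ m) → ℤΣ.sum (λ e → + f e) ≡ + sum f
sum-+ {zero}  f = refl
sum-+ {suc m} f = cong (ℤ._+_ (+ f zero)) (sum-+ (tail f))

partialSum-cong : ∀ {n} {u v : Vector ℤ n} → u ≗ v → partialSum u ≗ partialSum v
partialSum-cong u≗v zero            = u≗v zero
partialSum-cong {suc _} u≗v (suc i) = cong₂ ℤ._+_ (u≗v zero) (partialSum-cong (u≗v ∘ suc) i)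

-- Entries are successive differences of partial sums: cancel the common first entry and induct.
partialSum-injective : ∀ {n} {u v : Vector ℤ n} → partialSum u ≗ partialSum v → u ≗ v
partialSum-injective eq zero = eq zero
partialSum-injective {suc _} {u} {v} eq (suc i) = partialSum-injective
  (λ k → ∙-cancelˡ (u zero) _ _
    (trans (eq (suc k)) (cong (ℤ._+ partialSum (tail v) k) (sym (eq zero))))) i

partialSum-sum : ∀ {m n} (f : Fin m → Vector ℤ n) i →
  partialSum (λ k → ℤΣ.sum (λ e → f e k)) i ≡ ℤΣ.sum (λ e → partialSum (f e) i)
partialSum-sum f zero = refl
partialSum-sum {n = suc _} f (suc i) = trans
  (cong (ℤ._+_ (ℤΣ.sum (λ e → f e zero))) (partialSum-sum (tail ∘ f) i))
  (sym (ℤΣ.∑-distrib-+ (λ e → f e zero) (λ e → partialSum (tail (f e)) i)))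

partialSum-linear : ∀ {n} a (u v : Vector ℤ n) i →
  partialSum (λ k → a ℤ.* (u k ℤ.- v k)) i ≡ a ℤ.* (partialSum u i ℤ.- partialSum v i)
partialSum-linear a u v zero = refl
partialSum-linear {suc _} a u v (suc i) = trans
  (cong (ℤ._+_ (a ℤ.* (u zero ℤ.- v zero))) (partialSum-linear a (tail u) (tail v) i))
  (distrib a (u zero) (v zero) _ _)
  where
  distrib : ∀ a x y s t → a ℤ.* (x ℤ.- y) ℤ.+ a ℤ.* (s ℤ.- t) ≡ a ℤ.* ((x ℤ.+ s) ℤ.- (y ℤ.+ t))
  distrib = solve-∀

partialSum-0 : ∀ {n} (i : Fin n) → partialSum (const 0ℤ) i ≡ 0ℤ
partialSum-0 zero            = refl
partialSum-0 {suc _} (suc i) = trans (ℤ.+-identityˡ _) (partialSum-0 i)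

partialSum-basis : ∀ {n} (j i : Fin n) → partialSum (basis j) i ≡ + 𝟙 (j Fin.≤? i)
partialSum-basis zero    zero    = refl
partialSum-basis zero    (suc i) = cong (ℤ._+_ 1ℤ) (partialSum-0 i)
partialSum-basis (suc j) zero    = refl
partialSum-basis (suc j) (suc i) = begin
  0ℤ ℤ.+ partialSum (basis j) i  ≡⟨ ℤ.+-identityˡ _ ⟩
  partialSum (basis j) i         ≡⟨ partialSum-basis j i ⟩
  + 𝟙 (j Fin.≤? i)               ≡⟨ cong +_ (𝟙-cong (mk⇔ s≤s ℕ.s≤s⁻¹) (j Fin.≤? i) (suc j Fin.≤? suc i)) ⟩
  + 𝟙 (suc j Fin.≤? suc i)       ∎

partialSum-insertAt-fromℕ : ∀ {n} (c : Vector ℤ n) x →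
  partialSum (insertAt c (fromℕ n) x) (fromℕ n) ≡ ℤΣ.sum c ℤ.+ x
partialSum-insertAt-fromℕ {zero}  c x = sym (ℤ.+-identityˡ x)
partialSum-insertAt-fromℕ {suc n} c x = trans
  (cong (ℤ._+_ (head c)) (partialSum-insertAt-fromℕ (tail c) x))
  (sym (ℤ.+-assoc (head c) _ x))

-- The last vertex has no column of dots; this covers the remaining partial sum.
partialSum-netFlow : ∀ {n} (c : Vector ℤ n) → partialSum (netFlow c) (fromℕ n) ≡ 0ℤ
partialSum-netFlow c = trans (partialSum-insertAt-fromℕ c _) (ℤ.+-inverseʳ (ℤΣ.sum c))

-- Flows across a column

module _ {n : ℕ} (G : Graph n) where
  open Graph G

  -- At `inject₁ i` this unfolds to `_Spans_`; here `k` may also be the last vertex.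
  Crosses : Fin (suc n) → Pred Edge 0ℓ
  Crosses k e = src e Fin.≤ k × k Fin.< tgt e

  crosses? : ∀ k → Decidable (Crosses k)
  crosses? k e = (src e Fin.≤? k) ×-dec (k Fin.<? tgt e)

  -- The flow leaving the set of vertices up to `k`.
  cut : (Edge → ℕ) → Fin (suc n) → ℕ
  cut b k = sum (λ e → b e * 𝟙 (crosses? k e))

  𝟙-crosses : ∀ e k → + 𝟙 (src e Fin.≤? k) ℤ.- + 𝟙 (tgt e Fin.≤? k) ≡ + 𝟙 (crosses? k e)
  𝟙-crosses e k = 𝟙-difference (src e Fin.≤? k) (k Fin.<? tgt e) (tgt e Fin.≤? k)
    -- Edges increase, so a target at most `k` forces a source at most `k`.
    (ℕ.≤-trans (ℕ.<⇒≤ (src<tgt e))) ℕ.<⇒≱ ℕ.≮⇒≥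

  -- Partial sums commute with the sum over edges, and those of a basis vector form a step function;
  -- an edge contributes the step at its source minus the step at its target.
  partialSum-flow : ∀ b k →
    partialSum (λ j → ℤΣ.sum (λ e → + b e ℤ.* (basis (src e) j ℤ.- basis (tgt e) j))) k ≡ + cut b k
  partialSum-flow b k = begin
    partialSum (λ j → ℤΣ.sum (λ e → + b e ℤ.* (basis (src e) j ℤ.- basis (tgt e) j))) k
      ≡⟨ partialSum-sum (λ e j → + b e ℤ.* (basis (src e) j ℤ.- basis (tgt e) j)) k ⟩
    ℤΣ.sum (λ e → partialSum (λ j → + b e ℤ.* (basis (src e) j ℤ.- basis (tgt e) j)) k)
      ≡⟨ ℤΣ.sum-cong-≗ term ⟩
    ℤΣ.sum (λ e → + (b e * 𝟙 (crosses? k e)))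
      ≡⟨ sum-+ (λ e → b e * 𝟙 (crosses? k e)) ⟩
    + cut b k ∎
    where
    term : ∀ e → partialSum (λ j → + b e ℤ.* (basis (src e) j ℤ.- basis (tgt e) j)) k
               ≡ + (b e * 𝟙 (crosses? k e))
    term e = begin
      partialSum (λ j → + b e ℤ.* (basis (src e) j ℤ.- basis (tgt e) j)) k
        ≡⟨ partialSum-linear (+ b e) (basis (src e)) (basis (tgt e)) k ⟩
      + b e ℤ.* (partialSum (basis (src e)) k ℤ.- partialSum (basis (tgt e)) k)
        ≡⟨ cong (ℤ._*_ (+ b e)) (cong₂ ℤ._-_ (partialSum-basis (src e) k) (partialSum-basis (tgt e) k)) ⟩
      + b e ℤ.* (+ 𝟙 (src e Fin.≤? k) ℤ.- + 𝟙 (tgt e Fin.≤? k))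
        ≡⟨ cong (ℤ._*_ (+ b e)) (𝟙-crosses e k) ⟩
      + b e ℤ.* + 𝟙 (crosses? k e)
        ≡⟨ ℤ.pos-* (b e) _ ⟨
      + (b e * 𝟙 (crosses? k e)) ∎

  cut-fromℕ : ∀ b → cut b (fromℕ n) ≡ 0
  cut-fromℕ b = trans (sum-cong-≗ zeros) (trans (sum-const size 0) (ℕ.*-zeroʳ size))
    where
    zeros : ∀ e → b e * 𝟙 (crosses? (fromℕ n) e) ≡ 0
    zeros e = trans
      (cong (_*_ (b e)) (𝟙-false (crosses? (fromℕ n) e) λ (_ , n<t) → ℕ.<⇒≱ n<t (Fin.≤fromℕ (tgt e))))
      (ℕ.*-zeroʳ (b e))

  ≤cut : ∀ b {e k} → Crosses k e → b e ≤ cut b k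
  ≤cut b {e} {k} crosses = subst (_≤ cut b k)
    (trans (cong (_*_ (b e)) (𝟙-true (crosses? k e) crosses)) (ℕ.*-identityʳ (b e)))
    (entry≤sum (λ e → b e * 𝟙 (crosses? k e)) e)

  -- The source lies below the target, so it is not the last vertex and is itself a column. This
  -- bounds flows and makes lines nonempty.
  firstColumn : ∀ e → ∃ λ (i : Fin n) → Crosses (inject₁ i) e
  firstColumn e with src e | src<tgt e | view (src e)
  ... | _ | s<t | ‵fromℕ     = contradiction (Fin.≤fromℕ (tgt e)) (ℕ.<⇒≱ s<t)
  ... | _ | s<t | ‵inject₁ i = i , ℕ.≤-refl , s<t

  -- Flows and line-dot diagrams

  module _ (c : Vector ℤ n) where

    private
      c′ = netFlow c
      d  = simpleRootCoeff G c′

    isFlow⇒cut : ∀ b → IsFlow G c′ b → ∀ i → d i ≡ + cut b (inject₁ i)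
    isFlow⇒cut b flow i = trans (sym (partialSum-cong flow (inject₁ i))) (partialSum-flow b (inject₁ i))

    -- Partial sums determine a vector, and at the last vertex both partial sums vanish.
    cut⇒isFlow : ∀ b → (∀ i → d i ≡ + cut b (inject₁ i)) → IsFlow G c′ b
    cut⇒isFlow b eq = partialSum-injective λ k → trans (partialSum-flow b k) (sym (eq⁺ k))
      where
      eq⁺ : ∀ k → partialSum c′ k ≡ + cut b k
      eq⁺ k with view k
      ... | ‵fromℕ     = trans (partialSum-netFlow c) (cong +_ (sym (cut-fromℕ b)))
      ... | ‵inject₁ i = eq i

    isFlow? : Decidable (IsFlow G c′)
    isFlow? b = Fin.all? λ k → _ ℤ.≟ _

    isFlow-resp-≗ : ∀ {b b′} → b ≗ b′ → IsFlow G c′ b → IsFlow G c′ b′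
    isFlow-resp-≗ b≗b′ flow k =
      trans (ℤΣ.sum-cong-≗ (λ e → cong (λ x → + x ℤ.* _) (sym (b≗b′ e)))) (flow k)

    -- The flow on `e` is at most the cut at the first column of `e`, which is the number of dots
    -- there; summing over all columns makes the bound uniform in `e`.
    isFlow-bounded : ∀ b → IsFlow G c′ b → ∀ e → b e ≤ sum (λ i → ∣ d i ∣)
    isFlow-bounded b flow e with i , crosses ← firstColumn e =
      ℕ.≤-trans (≤cut b crosses)
        (ℕ.≤-trans (ℕ.≤-reflexive (sym (cong ∣_∣ (isFlow⇒cut b flow i)))) (entry≤sum (λ i → ∣ d i ∣) i))

    module _ (D : LineDotDiagram G c′) where
      open LineDotDiagram D

      columnEnumeration : ∀ i → Enumeration (Crosses (inject₁ i) ∘ edgeOf) ∣ d i ∣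
      columnEnumeration i = record
        { pick            = λ r → lineOf (i , r)
        ; pick-satisfies  = λ r → noOthers _ i r refl
        -- Both dots lie on one line, hence equal its only dot in column `i`.
        ; pick-injective  = λ {r} {r′} eq →
            let _ , _ , unique = oneDot _ i (noOthers _ i r′ refl)
            in trans (sym (unique eq)) (unique refl)
        ; pick-surjective = λ {l} spans → let r , eq , _ = oneDot l i spans in r , eq
        }

      -- Count the lines crossing column `i` twice: by their dots in that column, and grouped by
      -- their edges.
      multiplicity-isFlow : IsFlow G c′ multiplicity
      multiplicity-isFlow = cut⇒isFlow multiplicity λ i → begin
        d i
          ≡⟨ ℤ.0≤i⇒+∣i∣≡i (coeff≥0 i) ⟨
        + ∣ d i ∣
          ≡⟨ cong +_ (Enumeration-unique (columnEnumeration i) (enumerate (crosses? (inject₁ i) ∘ edgeOf))) ⟩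
        + sum (λ l → 𝟙 (crosses? (inject₁ i) (edgeOf l)))
          ≡⟨ cong +_ (sum-∘ edgeOf (λ e → 𝟙 (crosses? (inject₁ i) e))) ⟩
        + cut multiplicity (inject₁ i) ∎

    module _ {b : Edge → ℕ} (flow : IsFlow G c′ b) where

      private
        -- The lines crossing column `i` number `cut b (inject₁ i)`, which the flow condition
        -- equates with `∣ d i ∣`, so the dots can index them.
        E : ∀ i → Enumeration (Crosses (inject₁ i) ∘ withFibres b) ∣ d i ∣
        E i = subst (Enumeration _)
          (trans (sum-withFibres b (λ e → 𝟙 (crosses? (inject₁ i) e))) (sym (cong ∣_∣ (isFlow⇒cut b flow i))))
          (enumerate (crosses? (inject₁ i) ∘ withFibres b))

      diagram : LineDotDiagram G c′
      diagram = record
        { coeff≥0  = λ i → subst (0ℤ ℤ.≤_) (sym (isFlow⇒cut b flow i)) (ℤ.+≤+ ℕ.z≤n)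
        ; #lines   = sum b
        ; lineOf   = λ (i , r) → pick (E i) r
        -- Every line has a dot in the first column of its edge.
        ; nonempty = λ l → let i , crosses = firstColumn (withFibres b l)
                               r , eq = pick-surjective (E i) crosses
                           in (i , r) , eq
        ; edgeOf   = withFibres b
        ; oneDot   = λ l i spans → let r , eq = pick-surjective (E i) spans in
            r , eq , λ eq′ → pick-injective (E i) (trans eq (sym eq′))
        ; noOthers = λ { l i r refl → pick-satisfies (E i) r }
        }

    -- Both setoids compare only the numbers attached to edges, so congruence and injectivity are
    -- immediate; the content is surjectivity, given by `diagram`.
    gravityDiagrams⤖flows : Bijection (gravityDiagrams G c′) (flowSetoid G c′)
    gravityDiagrams⤖flows = record
      { to        = λ D → LineDotDiagram.multiplicity D , multiplicity-isFlow D
      ; cong      = λ eq → eq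
      ; bijective = (λ eq → eq)
                  , λ (b , flow) → diagram flow , λ eq e → trans (eq e) (count-withFibres b e)
      }

theorem3p1 : ∀ (n : ℕ) (G : Graph n) (c : Vector ℤ n) →
    ∃ λ k → KostantPartitionFunction G (netFlow c) k × HasCardinality (gravityDiagrams G (netFlow c)) k
theorem3p1 n G c =
  -- Finiteness of the set of flows supplies `k`; the diagrams get the same `k` by composing
  -- bijections.
  let k , flows = bounded⇒finite _ (IsFlow G (netFlow c)) (isFlow? G c)
                    (isFlow-resp-≗ G c) (isFlow-bounded G c)
  in k , flows , Compose.bijection (gravityDiagrams⤖flows G c) flows
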